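{- Let $\mathsf{CS}$ be an arbitrary constant specification for $\mathsf{JNoC}$. For each formula $F\in\mathcal{L}_J$, \[ \mathsf{JNoC}_{\mathsf{CS}}\vdash F \quad\text{if and only if}\quad F \text{ is NoC } \mathsf{CS}\text{ -valid}. \]
   Context: **Syntax.** Justification terms are built from countably many constants $c_i$ and countably many variables $x_i$ by $t::=c_i\mid x_i\mid t\cdot t\mid (t+t)\mid\, !t$; the set of terms is $\mathsf{Tm}$. Formulas are built from countably many atomic propositions $P_i$ and $\perp$ by $F::=P_i\mid\perp\mid F\to F\mid t:F$; the set of formulas is $\mathcal{L}_J$. The other Boolean connectives are defined as usual from $\to,\perp$; in particular $\neg A:=A\to\perp$ and $\top:=\neg\perp$. **Logic.** The axioms of $\mathsf{JNoC}$ are (for all terms $s,t$ and formulas $A,B$): (cl) all axioms of classical propositional logic (in the language $\mathcal{L}_J$); (j+) $s:A\lor t:A\to (s+t):A$; (j) $s:(A\to B)\to(t:A\to s\cdot t:B)$; (noc) $\neg(t:A\land t:\neg A)$. A constant specification for $\mathsf{JNoC}$ is a set $\mathsf{CS}\subseteq\{(c,A)\mid c\text{ a constant and }A\text{ an axiom of }\mathsf{JNoC}\}$. Write $!^n c$ for $c$ prefixed by $n$ copies of $!$. The logic $\mathsf{JNoC}_{\mathsf{CS}}$ is given by the axioms of $\mathsf{JNoC}$ and the rules modus ponens (from $A$ and $A\to B$ infer $B$) and axiom necessitation: for every $(c,A)\in\mathsf{CS}$ and $n\in\mathbb{N}$ (including $n=0$), infer $!^n c:\,!^{n-1}c:\cdots:\,!c:c:A$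 (for $n=0$ this is $c:A$). $\mathsf{JNoC}_{\mathsf{CS}}\vdash F$ means $F$ is derivable. **Semantics.** A NoC $\mathsf{CS}$-subset model is $\mathcal{M}=(W,W_0,V,E)$ where $W$ is a set (of worlds), $W_0\subseteq W$, $W_0\neq\emptyset$, and: - $V:W\times\mathcal{L}_J\to\{0,1\}$ is such that for all $\omega\in W_0$, $t\in\mathsf{Tm}$, $F,G\in\mathcal{L}_J$: $V(\omega,\perp)=0$; $V(\omega,F\to G)=1$ iff $V(\omega,F)=0$ or $V(\omega,G)=1$; $V(\omega,t:F)=1$ iff $E(\omega,t)\subseteq[F]$, where $[F]:=\{\upsilon\in W\mid V(\upsilon,F)=1\}$. (No conditions are imposed on $V$ at worlds outside $W_0$.) - $E:W\times\mathsf{Tm}\to\mathcal{P}(W)$ is such that for all $\omega\in W_0$ and $s,t\in\mathsf{Tm}$: (1) $E(\omega,s+t)\subseteq E(\omega,s)\cap E(\omega,t)$; (2) $E(\omega,s\cdot t)\subseteq\{\upsilon\in W\mid \forall F\in\mathsf{APP}_\omega(s,t)\ (\upsilon\in[F])\}$, where $\mathsf{APP}_\omega(s,t):=\{F\in\mathcal{L}_J\mid \exists H\in\mathcal{L}_J \text{ with } E(\omega,s)\subseteq[H\to F]\text{ and }E(\omega,t)\subseteq[H]\}$; (3) there exists $\upsilon\in W_{\mathsf{nc}}$ with $\upsilon\in E(\omega,t)$, where $W_{\mathsf{nc}}:=\{\upsilon\in W\mid \text{for all formulas }A:\ V(\upsilon,A)=0\text{ or }V(\upsilon,\neg A)=0\}$;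 (4) for all $(c,A)\in\mathsf{CS}$: $E(\omega,c)\subseteq[A]$, and for all $n\geq 1$, $E(\omega,!^n c)\subseteq[!^{n-1}c:\cdots:\,!c:c:A]$. Truth: $\mathcal{M},\omega\Vdash F$ iff $V(\omega,F)=1$. A formula $F$ is NoC $\mathsf{CS}$-valid if $\mathcal{M},\omega\Vdash F$ for every NoC $\mathsf{CS}$-subset model $\mathcal{M}=(W,W_0,V,E)$ and every $\omega\in W_0$. -}

module Defs where

open import Data.Bool.Base using (Bool; true; false)
open import Data.Nat.Base using (ℕ; zero; suc)
open import Data.Product.Base using (_×_; _,_; ∃; proj₂)
open import Data.Sum.Base using (_⊎_)
open import Function.Bundles using (_⇔_)
open import Level using (Level; 0ℓ; _⊔_) renaming (suc to lsuc)
open import Relation.Binary.PropositionalEquality.Core using (_≡_)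
open import Relation.Unary using (Pred; _∈_; _⊆_; _∩_; Satisfiable)

infixl 8 _·_
infixl 7 _+_
infix  9 !_

data Tm : Set where
  const : ℕ → Tm
  var   : ℕ → Tm
  _·_   : Tm → Tm → Tm
  _+_   : Tm → Tm → Tm
  !_    : Tm → Tm

infixr 6 _∶_
infixr 3 _⊃_
infixr 5 _∧_
infixr 4 _∨_
infix  7 ~_

data Fm : Set where
  atom : ℕ → Fm
  ⊥̇    : Fm
  _⊃_  : Fm → Fm → Fm
  _∶_  : Tm → Fm → Fm

~_ : Fm → Fm
~ A = A ⊃ ⊥̇

_∨_ : Fm → Fm → Fm
A ∨ B = ~ A ⊃ B

_∧_ : Fm → Fm → Fm
A ∧ B = ~ (A ⊃ ~ B)

-- The first three schemes are a standard complete axiomatisation of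
-- classical propositional logic over ⊃ and ⊥̇, with modus ponens.
data Axiom : Pred Fm 0ℓ where
  cl-k : ∀ A B → Axiom (A ⊃ B ⊃ A)
  cl-s : ∀ A B C → Axiom ((A ⊃ B ⊃ C) ⊃ (A ⊃ B) ⊃ A ⊃ C)
  cl-n : ∀ A → Axiom (~ (~ A) ⊃ A)
  j+   : ∀ s t A → Axiom ((s ∶ A) ∨ (t ∶ A) ⊃ (s + t) ∶ A)
  j    : ∀ s t A B → Axiom (s ∶ (A ⊃ B) ⊃ t ∶ A ⊃ (s · t) ∶ B)
  noc  : ∀ t A → Axiom (~ ((t ∶ A) ∧ (t ∶ (~ A))))

-- (c , A) pairs the formula A with the constant of index c.
IsConstantSpecification : Pred (ℕ × Fm) 0ℓ → Set
IsConstantSpecification CS = CS ⊆ λ cA → Axiom (proj₂ cA)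

bang : ℕ → Tm → Tm
bang zero    t = t
bang (suc n) t = ! bang n t

-- !ⁿ c : !ⁿ⁻¹ c : ⋯ : ! c : c : A
necessitation : ℕ → ℕ → Fm → Fm
necessitation zero    c A = const c ∶ A
necessitation (suc n) c A = bang (suc n) (const c) ∶ necessitation n c A

infix 2 _⊢_

data _⊢_ (CS : Pred (ℕ × Fm) 0ℓ) : Pred Fm 0ℓ where
  ax : ∀ {A} → Axiom A → CS ⊢ A
  mp : ∀ {A B} → CS ⊢ A → CS ⊢ A ⊃ B → CS ⊢ B
  an : ∀ {c A} → (c , A) ∈ CS → ∀ n → CS ⊢ necessitation n c A

record Model (w ℓ : Level) (CS : Pred (ℕ × Fm) 0ℓ) : Set (lsuc (w ⊔ ℓ)) where
  field
    W  : Set w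
    W₀ : Pred W ℓ
    V  : W → Fm → Bool
    E  : W → Tm → Pred W ℓ

  [_] : Fm → Pred W 0ℓ
  [ F ] υ = V υ F ≡ true

  APP : W → Tm → Tm → Pred Fm (w ⊔ ℓ)
  APP ω s t F = ∃ λ H → (E ω s ⊆ [ H ⊃ F ]) × (E ω t ⊆ [ H ])

  W-nc : Pred W 0ℓ
  W-nc υ = ∀ A → V υ A ≡ false ⊎ V υ (~ A) ≡ false

  field
    W₀-nonempty : Satisfiable W₀

    V-⊥̇ : ∀ {ω} → ω ∈ W₀ → V ω ⊥̇ ≡ false
    V-⊃ : ∀ {ω} → ω ∈ W₀ → ∀ F G →
          V ω (F ⊃ G) ≡ true ⇔ (V ω F ≡ false ⊎ V ω G ≡ true)
    V-∶ : ∀ {ω} → ω ∈ W₀ → ∀ t F →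
          V ω (t ∶ F) ≡ true ⇔ E ω t ⊆ [ F ]

    E-+   : ∀ {ω} → ω ∈ W₀ → ∀ s t → E ω (s + t) ⊆ E ω s ∩ E ω t
    E-·   : ∀ {ω} → ω ∈ W₀ → ∀ s t →
            E ω (s · t) ⊆ λ υ → ∀ F → F ∈ APP ω s t → υ ∈ [ F ]
    E-noc : ∀ {ω} → ω ∈ W₀ → ∀ t → Satisfiable (W-nc ∩ E ω t)
    E-CS  : ∀ {ω} → ω ∈ W₀ → ∀ {c A} → (c , A) ∈ CS → E ω (const c) ⊆ [ A ]
    E-CS! : ∀ {ω} → ω ∈ W₀ → ∀ {c A} → (c , A) ∈ CS → ∀ n →
            E ω (bang (suc n) (const c)) ⊆ [ necessitation n c A ]

infix 4 _,_⊩_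

_,_⊩_ : ∀ {w ℓ CS} (M : Model w ℓ CS) → Model.W M → Fm → Set
M , ω ⊩ F = Model.V M ω F ≡ true

Valid : ∀ w ℓ → Pred (ℕ × Fm) 0ℓ → Fm → Set (lsuc (w ⊔ ℓ))
Valid w ℓ CS F = (M : Model w ℓ CS) → ∀ {ω} → ω ∈ Model.W₀ M → M , ω ⊩ F

{-# OPTIONS --safe #-}

-- Completeness uses a canonical model whose worlds are all functions Fm → Bool,
-- the normal ones being those that respect ⊥̇ and ⊃ and contain every theorem.
-- Put E(ω,t) = {υ ∣ υ satisfies every F with ω(t:F) = 1}. Since nothing is
-- required of other worlds, υ F = ω(t:F) is itself a world of E(ω,t); it refutes
-- every F with ω(t:F) = 0, and by (noc) it contains no formula together with its
-- negation. This gives the truth condition for t:F and condition (3), and the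
-- remaining conditions are read off the axioms. Lindenbaum's lemma yields, for an
-- unprovable F, a normal world refuting F.
module Submission where

open import Defs
open import Axiom.ExcludedMiddle using (ExcludedMiddle)
open import Data.Bool.Base using (Bool; true; false)
open import Data.List.Base using (List; []; _∷_; _++_; map; upTo; foldl; cartesianProductWith)
open import Data.List.Membership.Propositional using () renaming (_∈_ to _∈ˡ_)
open import Data.List.Membership.Propositional.Properties
  using (∈-++⁺ˡ; ∈-++⁺ʳ; ∈-map⁺; ∈-upTo⁺; ∈-cartesianProductWith⁺)
open import Data.List.Relation.Unary.Any using (here; there)
open import Data.Nat.Base using (ℕ; zero; suc; s≤s; _≤_; _⊔_; _≤′_; ≤′-refl; ≤′-step)
open import Data.Nat.Properties using (≤-refl; ≤⇒≤′; m≤m⊔n; m≤n⊔m; m⊔n≤o⇒m≤o; m⊔n≤o⇒n≤o)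
open import Data.Product.Base using (_×_; _,_; ∃; proj₁; proj₂)
open import Data.Sum.Base using (_⊎_; inj₁; inj₂; [_,_]′)
open import Function.Bundles using (_⇔_; mk⇔; Equivalence)
open import Level using (Level; 0ℓ; Lift; lift; lower)
open import Relation.Binary.PropositionalEquality
  using (_≡_; refl; sym; trans)
open import Relation.Nullary using (¬_; does; yes; no; contradiction)
open import Relation.Unary using (Pred; _∈_)

-- Valuations that respect `⊥̇` and `⊃`

record IsClassical (v : Fm → Bool) : Set where
  field
    ⊥̇-false : v ⊥̇ ≡ false
    ⊃-true  : ∀ F G → v (F ⊃ G) ≡ true ⇔ (v F ≡ false ⊎ v G ≡ true)

  ⊥̇-elim : ∀ {a} {A : Set a} → v ⊥̇ ≡ true → A
  ⊥̇-elim p with () ← trans (sym p) ⊥̇-false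

  ⊃-intro : ∀ {F G} → (v F ≡ true → v G ≡ true) → v (F ⊃ G) ≡ true
  ⊃-intro {F} {G} f with v F in eq
  ... | false = Equivalence.from (⊃-true F G) (inj₁ eq)
  ... | true  = Equivalence.from (⊃-true F G) (inj₂ (f refl))

  ⊃-elim : ∀ {F G} → v (F ⊃ G) ≡ true → v F ≡ true → v G ≡ true
  ⊃-elim {F} {G} p q with Equivalence.to (⊃-true F G) p
  ... | inj₂ r = r
  ... | inj₁ r with () ← trans (sym q) r

  ~~-elim : ∀ {F} → v (~ ~ F) ≡ true → v F ≡ true
  ~~-elim {F} p with v F in eq
  ... | true  = refl
  ... | false = ⊥̇-elim (⊃-elim p (Equivalence.from (⊃-true F ⊥̇) (inj₁ eq)))

  ∨-introˡ : ∀ {F G} → v F ≡ true → v (F ∨ G) ≡ true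
  ∨-introˡ p = ⊃-intro λ q → ⊥̇-elim (⊃-elim q p)

  ∨-introʳ : ∀ {F G} → v G ≡ true → v (F ∨ G) ≡ true
  ∨-introʳ p = ⊃-intro λ _ → p

  ∨-elim : ∀ {F G} → v (F ∨ G) ≡ true → v F ≡ true ⊎ v G ≡ true
  ∨-elim {F} p with v F in eq
  ... | true  = inj₁ refl
  ... | false = inj₂ (⊃-elim p (Equivalence.from (⊃-true F ⊥̇) (inj₁ eq)))

  ∧-intro : ∀ {F G} → v F ≡ true → v G ≡ true → v (F ∧ G) ≡ true
  ∧-intro p q = ⊃-intro λ r → ⊃-elim (⊃-elim r p) q

  ∧-elimˡ : ∀ {F G} → v (F ∧ G) ≡ true → v F ≡ true
  ∧-elimˡ p = ~~-elim (⊃-intro λ q → ⊃-elim p (⊃-intro λ r → ⊥̇-elim (⊃-elim q r)))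

  ∧-elimʳ : ∀ {F G} → v (F ∧ G) ≡ true → v G ≡ true
  ∧-elimʳ p = ~~-elim (⊃-intro λ q → ⊃-elim p (⊃-intro λ _ → q))

-- Soundness at the normal worlds of a model

module Soundness {w ℓ CS} (M : Model w ℓ CS) {ω} (ω∈W₀ : ω ∈ Model.W₀ M) where
  open Model M

  classical : IsClassical (V ω)
  classical = record { ⊥̇-false = V-⊥̇ ω∈W₀ ; ⊃-true = V-⊃ ω∈W₀ }

  open IsClassical classical

  ∶-intro : ∀ {t F} → (∀ {υ} → E ω t υ → V υ F ≡ true) → V ω (t ∶ F) ≡ true
  ∶-intro {t} {F} = Equivalence.from (V-∶ ω∈W₀ t F)

  ∶-elim : ∀ {t F} → V ω (t ∶ F) ≡ true → ∀ {υ} → E ω t υ → V υ F ≡ true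
  ∶-elim {t} {F} = Equivalence.to (V-∶ ω∈W₀ t F)

  axiom-sound : ∀ {F} → Axiom F → V ω F ≡ true
  axiom-sound (cl-k A B)   = ⊃-intro λ a → ⊃-intro λ _ → a
  axiom-sound (cl-s A B C) =
    ⊃-intro λ f → ⊃-intro λ g → ⊃-intro λ a → ⊃-elim (⊃-elim f a) (⊃-elim g a)
  axiom-sound (cl-n A)     = ⊃-intro ~~-elim
  axiom-sound (j+ s t A)   = ⊃-intro λ p → ∶-intro λ e →
    [ (λ q → ∶-elim q (proj₁ (E-+ ω∈W₀ s t e)))
    , (λ q → ∶-elim q (proj₂ (E-+ ω∈W₀ s t e))) ]′ (∨-elim p)
  axiom-sound (j s t A B)  = ⊃-intro λ p → ⊃-intro λ q → ∶-intro λ e →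
    -- `A` is the witness `H` that puts `B` into `APP ω s t`.
    E-· ω∈W₀ s t e B (A , ∶-elim p , ∶-elim q)
  axiom-sound (noc t A)    = ⊃-intro λ p → noc-absurd (∧-elimˡ p) (∧-elimʳ p)
    where
    -- `p` and `q` make `A` and `~ A` true throughout `E ω t`, but `E-noc` supplies a world there
    -- that falsifies one of them.
    noc-absurd : ∀ {B : Set} → V ω (t ∶ A) ≡ true → V ω (t ∶ ~ A) ≡ true → B
    noc-absurd p q with E-noc ω∈W₀ t
    ... | υ , nc , e with nc A
    ...   | inj₁ r with () ← trans (sym r) (∶-elim p e)
    ...   | inj₂ r with () ← trans (sym r) (∶-elim q e)

  sound : ∀ {F} → CS ⊢ F → V ω F ≡ true
  sound (ax a)          = axiom-sound a
  sound (mp d e)        = ⊃-elim (sound e) (sound d)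
  sound (an cs zero)    = ∶-intro (E-CS ω∈W₀ cs)
  sound (an cs (suc n)) = ∶-intro (E-CS! ω∈W₀ cs n)

-- Finite lists exhausting terms and formulas by rank

terms : ℕ → List Tm
terms zero    = []
terms (suc n) =
  -- The indices are 0 to n, exactly those `i` with `suc i ≤ suc n`.
  map const (upTo (suc n)) ++
  map var (upTo (suc n)) ++
  cartesianProductWith _·_ (terms n) (terms n) ++
  cartesianProductWith _+_ (terms n) (terms n) ++
  map !_ (terms n)

formulas : ℕ → List Fm
formulas zero    = []
formulas (suc n) =
  map atom (upTo (suc n)) ++
  cartesianProductWith _⊃_ (formulas n) (formulas n) ++
  cartesianProductWith _∶_ (terms n) (formulas n) ++
  ⊥̇ ∷ []

-- Indices count towards the rank, so that each rank has finitely many terms.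
termRank : Tm → ℕ
termRank (const i) = suc i
termRank (var i)   = suc i
termRank (s · t)   = suc (termRank s ⊔ termRank t)
termRank (s + t)   = suc (termRank s ⊔ termRank t)
termRank (! t)     = suc (termRank t)

rank : Fm → ℕ
rank (atom i) = suc i
rank ⊥̇        = 1
rank (A ⊃ B)  = suc (rank A ⊔ rank B)
rank (t ∶ A)  = suc (termRank t ⊔ rank A)

-- An arbitrary bound `n` lets one list serve both arguments of a binary operation, whose ranks may
-- differ.
∈-terms : ∀ t {n} → termRank t ≤ n → t ∈ˡ terms n
∈-terms (const i) (s≤s p) = ∈-++⁺ˡ (∈-map⁺ const (∈-upTo⁺ (s≤s p)))
∈-terms (var i) {suc n} (s≤s p) =
  ∈-++⁺ʳ (map const (upTo (suc n))) (∈-++⁺ˡ (∈-map⁺ var (∈-upTo⁺ (s≤s p))))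
∈-terms (s · t) {suc n} (s≤s p) =
  ∈-++⁺ʳ (map const (upTo (suc n))) (∈-++⁺ʳ (map var (upTo (suc n)))
    (∈-++⁺ˡ (∈-cartesianProductWith⁺ _·_
      (∈-terms s (m⊔n≤o⇒m≤o _ _ p)) (∈-terms t (m⊔n≤o⇒n≤o (termRank s) _ p)))))
∈-terms (s + t) {suc n} (s≤s p) =
  ∈-++⁺ʳ (map const (upTo (suc n))) (∈-++⁺ʳ (map var (upTo (suc n)))
    (∈-++⁺ʳ (cartesianProductWith _·_ (terms n) (terms n))
      (∈-++⁺ˡ (∈-cartesianProductWith⁺ _+_
        (∈-terms s (m⊔n≤o⇒m≤o _ _ p)) (∈-terms t (m⊔n≤o⇒n≤o (termRank s) _ p))))))
∈-terms (! t) {suc n} (s≤s p) =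
  ∈-++⁺ʳ (map const (upTo (suc n))) (∈-++⁺ʳ (map var (upTo (suc n)))
    (∈-++⁺ʳ (cartesianProductWith _·_ (terms n) (terms n))
      (∈-++⁺ʳ (cartesianProductWith _+_ (terms n) (terms n))
        (∈-map⁺ !_ (∈-terms t p)))))

∈-formulas : ∀ F {n} → rank F ≤ n → F ∈ˡ formulas n
∈-formulas (atom i) (s≤s p) = ∈-++⁺ˡ (∈-map⁺ atom (∈-upTo⁺ (s≤s p)))
∈-formulas (A ⊃ B) {suc n} (s≤s p) =
  ∈-++⁺ʳ (map atom (upTo (suc n))) (∈-++⁺ˡ (∈-cartesianProductWith⁺ _⊃_
    (∈-formulas A (m⊔n≤o⇒m≤o _ _ p)) (∈-formulas B (m⊔n≤o⇒n≤o (rank A) _ p))))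
∈-formulas (t ∶ A) {suc n} (s≤s p) =
  ∈-++⁺ʳ (map atom (upTo (suc n))) (∈-++⁺ʳ (cartesianProductWith _⊃_ (formulas n) (formulas n))
    (∈-++⁺ˡ (∈-cartesianProductWith⁺ _∶_
      (∈-terms t (m⊔n≤o⇒m≤o _ _ p)) (∈-formulas A (m⊔n≤o⇒n≤o (termRank t) _ p)))))
∈-formulas ⊥̇ {suc n} (s≤s p) =
  ∈-++⁺ʳ (map atom (upTo (suc n))) (∈-++⁺ʳ (cartesianProductWith _⊃_ (formulas n) (formulas n))
    (∈-++⁺ʳ (cartesianProductWith _∶_ (terms n) (formulas n)) (here refl)))

-- Propositional derivations

module Derivations {CS : Pred (ℕ × Fm) 0ℓ} where

  weaken : ∀ {A B} → CS ⊢ B → CS ⊢ A ⊃ B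
  weaken d = mp d (ax (cl-k _ _))

  mp-under : ∀ {A B C} → CS ⊢ A ⊃ B → CS ⊢ A ⊃ B ⊃ C → CS ⊢ A ⊃ C
  mp-under d e = mp d (mp e (ax (cl-s _ _ _)))

  ⊃-refl : ∀ {A} → CS ⊢ A ⊃ A
  ⊃-refl {A} = mp-under {B = A ⊃ A} (ax (cl-k _ _)) (ax (cl-k _ _))

  ⊃-trans : ∀ {A B C} → CS ⊢ A ⊃ B → CS ⊢ B ⊃ C → CS ⊢ A ⊃ C
  ⊃-trans d e = mp-under d (weaken e)

  ex-falso : ∀ {A} → CS ⊢ ⊥̇ ⊃ A
  ex-falso = ⊃-trans (ax (cl-k _ _)) (ax (cl-n _))

  postcompose : ∀ {A B C} → CS ⊢ B ⊃ C → CS ⊢ (A ⊃ B) ⊃ A ⊃ C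
  postcompose d = mp (weaken d) (ax (cl-s _ _ _))

  contradiction-under : ∀ {A B} → CS ⊢ ~ A ⊃ A ⊃ B
  contradiction-under = postcompose ex-falso

  -- Under `~ B`, `cl-k` gives `~ A ⊃ ~ B`, and `cl-s` combines it with `d` into `~ ~ A`. As `A ∧ B`
  -- is the negation of `A ⊃ ~ B`, both projections are instances.
  contraposition : ∀ {A B} → CS ⊢ ~ A ⊃ B → CS ⊢ ~ B ⊃ A
  contraposition d = ⊃-trans
    (mp-under (weaken d) (⊃-trans (ax (cl-k _ _)) (ax (cl-s _ _ _))))
    (ax (cl-n _))

  ∧-projˡ : ∀ {A B} → CS ⊢ A ∧ B ⊃ A
  ∧-projˡ = contraposition contradiction-under

  ∧-projʳ : ∀ {A B} → CS ⊢ A ∧ B ⊃ B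
  ∧-projʳ = contraposition (ax (cl-k _ _))

-- Lindenbaum's lemma

-- A finite set of formulas is represented by its conjunction X.
module Lindenbaum (em : ExcludedMiddle 0ℓ) (CS : Pred (ℕ × Fm) 0ℓ) where
  open Derivations {CS}

  Consistent : Fm → Set
  Consistent X = ¬ (CS ⊢ ~ X)

  Decides : Fm → Fm → Set
  Decides X A = CS ⊢ X ⊃ A ⊎ CS ⊢ X ⊃ ~ A

  extend : Fm → Fm → Fm
  extend X A with em {CS ⊢ X ⊃ ~ A}
  ... | yes _ = X
  ... | no  _ = X ∧ A

  extend-⊃ : ∀ X A → CS ⊢ extend X A ⊃ X
  extend-⊃ X A with em {CS ⊢ X ⊃ ~ A}
  ... | yes _ = ⊃-refl
  ... | no  _ = ∧-projˡ

  extend-decides : ∀ X A → Decides (extend X A) A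
  extend-decides X A with em {CS ⊢ X ⊃ ~ A}
  ... | yes d = inj₂ d
  ... | no  _ = inj₁ ∧-projʳ

  extend-consistent : ∀ {X} A → Consistent X → Consistent (extend X A)
  extend-consistent {X} A con with em {CS ⊢ X ⊃ ~ A}
  ... | yes _  = con
  -- `~ (X ∧ A)` unfolds to `~ ~ (X ⊃ ~ A)`.
  ... | no  ¬d = λ d → ¬d (mp d (ax (cl-n _)))

  decides-mono : ∀ {X Y A} → CS ⊢ Y ⊃ X → Decides X A → Decides Y A
  decides-mono d (inj₁ e) = inj₁ (⊃-trans d e)
  decides-mono d (inj₂ e) = inj₂ (⊃-trans d e)

  foldl-⊃ : ∀ X As → CS ⊢ foldl extend X As ⊃ X
  foldl-⊃ X []       = ⊃-refl
  foldl-⊃ X (A ∷ As) = ⊃-trans (foldl-⊃ (extend X A) As) (extend-⊃ X A)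

  -- Later extensions only strengthen the conjunction, so a decision once made persists.
  foldl-decides : ∀ X {A As} → A ∈ˡ As → Decides (foldl extend X As) A
  foldl-decides X {A} {_ ∷ As} (here refl) =
    decides-mono (foldl-⊃ (extend X A) As) (extend-decides X A)
  foldl-decides X (there p) = foldl-decides (extend X _) p

  foldl-consistent : ∀ {X} As → Consistent X → Consistent (foldl extend X As)
  foldl-consistent []       con = con
  foldl-consistent (A ∷ As) con = foldl-consistent As (extend-consistent A con)

  module Completion (X : Fm) (con : Consistent X) where

    -- Each step treats a whole finite list, so the lists by rank take the place of an enumeration
    -- of formulas.
    stage : ℕ → Fm
    stage zero    = X
    stage (suc n) = foldl extend (stage n) (formulas n)

    stage-consistent : ∀ n → Consistent (stage n)
    stage-consistent zero    = con
    stage-consistent (suc n) = foldl-consistent (formulas n) (stage-consistent n)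

    stage-⊃′ : ∀ {m n} → m ≤′ n → CS ⊢ stage n ⊃ stage m
    stage-⊃′ ≤′-refl     = ⊃-refl
    stage-⊃′ (≤′-step {n} p) = ⊃-trans (foldl-⊃ (stage n) (formulas n)) (stage-⊃′ p)

    stage-⊃ : ∀ {m n} → m ≤ n → CS ⊢ stage n ⊃ stage m
    stage-⊃ p = stage-⊃′ (≤⇒≤′ p)

    -- The maximal consistent set containing `X`: all consequences of the stages.
    Theory : Pred Fm 0ℓ
    Theory A = ∃ λ n → CS ⊢ stage n ⊃ A

    theory-mp : ∀ {A B} → Theory (A ⊃ B) → Theory A → Theory B
    -- Both premises are moved to the later of the two stages.
    theory-mp (m , d) (n , e) = m ⊔ n ,
      mp-under (⊃-trans (stage-⊃ (m≤n⊔m m n)) e) (⊃-trans (stage-⊃ (m≤m⊔n m n)) d)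

    theorem-∈ : ∀ {A} → CS ⊢ A → Theory A
    theorem-∈ d = 0 , weaken d

    ⊥̇-∉ : ¬ Theory ⊥̇
    ⊥̇-∉ (n , d) = stage-consistent n d

    -- `A` occurs in `formulas (rank A)`, hence is decided one stage later.
    theory-complete : ∀ A → Theory A ⊎ Theory (~ A)
    theory-complete A with foldl-decides (stage (rank A)) (∈-formulas A ≤-refl)
    ... | inj₁ d = inj₁ (suc (rank A) , d)
    ... | inj₂ d = inj₂ (suc (rank A) , d)

    char : Fm → Bool
    char A = does (em {Theory A})

    char-true : ∀ {A} → Theory A → char A ≡ true
    char-true {A} p with em {Theory A}
    ... | yes _  = refl
    ... | no  ¬p = contradiction p ¬p

    char-false : ∀ {A} → ¬ Theory A → char A ≡ false
    char-false {A} ¬p with em {Theory A}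
    ... | yes p = contradiction p ¬p
    ... | no  _ = refl

    char-classical : IsClassical char
    char-classical = record
      { ⊥̇-false = char-false ⊥̇-∉
      ; ⊃-true  = λ F G → mk⇔ (to F G) (from F G)
      }
      where
      to : ∀ F G → char (F ⊃ G) ≡ true → char F ≡ false ⊎ char G ≡ true
      to F G p with em {Theory F} | em {Theory (F ⊃ G)}
      ... | no  _ | _     = inj₁ refl
      ... | yes q | yes r = inj₂ (char-true (theory-mp r q))

      from : ∀ F G → char F ≡ false ⊎ char G ≡ true → char (F ⊃ G) ≡ true
      from F G (inj₁ p) with em {Theory F} | theory-complete F
      ... | no ¬q | inj₁ q = contradiction q ¬q
      ... | no ¬q | inj₂ q = char-true (theory-mp (theorem-∈ contradiction-under) q)
      from F G (inj₂ p) with em {Theory G}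
      ... | yes q = char-true (theory-mp (theorem-∈ (ax (cl-k _ _))) q)

  record IsNormal (v : Fm → Bool) : Set where
    field
      isClassical  : IsClassical v
      theorem-true : ∀ {A} → CS ⊢ A → v A ≡ true

  -- The completion starts from `~ F`, which is consistent because `cl-n` turns a derivation of
  -- `~ ~ F` into one of `F`.
  lindenbaum : ∀ {F} → ¬ (CS ⊢ F) → ∃ λ v → IsNormal v × v F ≡ false
  lindenbaum {F} ¬d = char ,
    record { isClassical = char-classical ; theorem-true = λ d → char-true (theorem-∈ d) } ,
    -- `~ F` is in the theory already at stage 0, so `F` would bring in `⊥̇`.
    char-false (λ p → ⊥̇-∉ (theory-mp (0 , ⊃-refl) p))
    where open Completion (~ F) (λ d → ¬d (mp d (ax (cl-n _))))

-- The canonical model and completeness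

module Completeness (em : ExcludedMiddle 0ℓ) (w ℓ : Level) (CS : Pred (ℕ × Fm) 0ℓ) where
  open Lindenbaum em CS

  Accessible : (Fm → Bool) → Tm → Pred (Fm → Bool) 0ℓ
  Accessible v t u = ∀ {F} → v (t ∶ F) ≡ true → u F ≡ true

  module _ {v : Fm → Bool} (normal : IsNormal v) where
    open IsNormal normal
    open IsClassical isClassical

    implied-true : ∀ {A B} → CS ⊢ A ⊃ B → v A ≡ true → v B ≡ true
    implied-true d = ⊃-elim (theorem-true d)

    -- Places the world `λ F → v (t ∶ F)` in `W-nc`.
    section-nc : ∀ t A → v (t ∶ A) ≡ false ⊎ v (t ∶ ~ A) ≡ false
    section-nc t A with v (t ∶ A) in p | v (t ∶ ~ A) in q
    ... | false | _     = inj₁ refl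
    ... | true  | false = inj₂ refl
    ... | true  | true  = ⊥̇-elim (implied-true (ax (noc t A)) (∧-intro p q))

  -- The given normal world serves to make `W₀` nonempty; `Lift` reaches the arbitrary levels `w`
  -- and `ℓ`.
  canonical : ∀ {v} → IsNormal v → Model w ℓ CS
  canonical {v₀} normal₀ = record
    { W  = Lift w (Fm → Bool)
    ; W₀ = λ ω → Lift ℓ (IsNormal (lower ω))
    ; V  = lower
    ; E  = λ ω t υ → Lift ℓ (Accessible (lower ω) t (lower υ))
    ; W₀-nonempty = lift v₀ , lift normal₀
    ; V-⊥̇ = λ (lift n) → IsClassical.⊥̇-false (IsNormal.isClassical n)
    ; V-⊃ = λ (lift n) → IsClassical.⊃-true (IsNormal.isClassical n)
    ; V-∶ = λ {ω} _ t F → mk⇔ (λ p {_} e → lower e p) (at-section (lower ω) t F)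
    -- By `j+`, whatever `s` or `t` justifies is justified by `s + t`, which therefore constrains
    -- `υ` at least as much.
    ; E-+ = λ (lift n) s t (lift e) →
        lift (λ p → e (implied-true n (ax (j+ s t _)) (IsClassical.∨-introˡ (IsNormal.isClassical n) p))) ,
        lift (λ p → e (implied-true n (ax (j+ s t _)) (IsClassical.∨-introʳ (IsNormal.isClassical n) p)))
    -- The inclusions behind `APP`, evaluated at the worlds given by `s` and `t`, yield
    -- `s ∶ (H ⊃ F)` and `t ∶ H` at `ω`; then `j` applies.
    ; E-· = λ {ω} (lift n) s t (lift e) F (H , f , g) →
        e (IsClassical.⊃-elim (IsNormal.isClassical n)
             (implied-true n (ax (j s t H F)) (at-section (lower ω) s (H ⊃ F) f)) (at-section (lower ω) t H g))
    ; E-noc = λ {ω} (lift n) t → lift (λ F → lower ω (t ∶ F)) , section-nc n t , lift (λ p → p)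
    ; E-CS  = λ (lift n) cs (lift e) → e (IsNormal.theorem-true n (an cs zero))
    ; E-CS! = λ (lift n) cs k (lift e) → e (IsNormal.theorem-true n (an cs (suc k)))
    }
    where
    -- The hypothesis is used at one world, `λ G → v (t ∶ G)`, which is accessible by definition and
    -- takes the value `v (t ∶ F)` at `F`.
    at-section : ∀ v t F →
      (∀ {υ : Lift w (Fm → Bool)} → Lift ℓ (Accessible v t (lower υ)) → lower υ F ≡ true) →
      v (t ∶ F) ≡ true
    at-section v t F f = f {lift (λ G → v (t ∶ G))} (lift (λ p → p))

  complete : ∀ {F} → Valid w ℓ CS F → CS ⊢ F
  complete {F} valid with em {CS ⊢ F}
  ... | yes d = d
  ... | no ¬d with v , normal , p ← lindenbaum ¬d
              with () ← trans (sym p) (valid (canonical normal) (lift normal))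

theorem16 : ExcludedMiddle 0ℓ →
    ∀ w ℓ (CS : Pred (ℕ × Fm) 0ℓ) → IsConstantSpecification CS →
    ∀ F → (CS ⊢ F) ⇔ Valid w ℓ CS F
theorem16 em w ℓ CS _ F =
  mk⇔ (λ d M {_} ω∈W₀ → Soundness.sound M ω∈W₀ d) (Completeness.complete em w ℓ CS)
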